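{- Let $m>2$ be an integer and let $\mu$ be a proper edge-coloring of the complete graph $K_{2m}$ with $2m-1$ colors such that for any two distinct colors, the edges of those two colors form a 2-factor of $K_{2m}$ each of whose components is a 4-cycle. Then the edge set of $K_{2m}$ can be partitioned into $m$ pairwise isomorphic multicolored spanning trees.
   Context: An edge-coloring is proper if any two edges sharing a vertex receive distinct colors. A subgraph of an edge-colored graph is multicolored if no two of its edges have the same color. A spanning tree of $K_{2m}$ is a subgraph that is a tree and contains all $2m$ vertices. -}

module Defs where

open import Level using (0ℓ)
open import Data.Nat using (ℕ; _*_; _∸_; _≤_)
open import Data.Fin using (Fin)
open import Data.List using (List; []; _∷_; _++_; length)
open import Data.List.Relation.Unary.Linked using (Linked)
open import Data.List.Relation.Unary.Unique.Propositional using (Unique)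
open import Data.Product using (Σ; _×_; ∃; ∃-syntax)
open import Data.Sum using (_⊎_)
open import Relation.Nullary using (¬_)
open import Relation.Binary.PropositionalEquality using (_≡_; _≢_)
open import Relation.Binary.Construct.Closure.ReflexiveTransitive using (Star)
open import Function.Bundles using (_↔_; Inverse)

Graph : ℕ → Set₁
Graph n = Fin n → Fin n → Set

-- Edge-colourings of K_n with k colours: a colour for every ordered pair,
-- required to be symmetric; values on the diagonal are irrelevant.
Colouring : ℕ → ℕ → Set
Colouring n k = Fin n → Fin n → Fin k

Symmetric : ∀ {n k} → Colouring n k → Set
Symmetric {n} μ = ∀ (u v : Fin n) → μ u v ≡ μ v u

Proper : ∀ {n k} → Colouring n k → Set
Proper {n} μ = ∀ (u v w : Fin n) → u ≢ v → u ≢ w → v ≢ w → μ u v ≢ μ u w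

TwoColourGraph : ∀ {n k} → Colouring n k → Fin k → Fin k → Graph n
TwoColourGraph μ c d u v = u ≢ v × (μ u v ≡ c ⊎ μ u v ≡ d)

TwoFactor : ∀ {n} → Graph n → Set
TwoFactor {n} H = ∀ (u : Fin n) → ∃[ a ] ∃[ b ]
  (a ≢ b × H u a × H u b × (∀ w → H u w → w ≡ a ⊎ w ≡ b))

OnFourCycle : ∀ {n} → Graph n → Fin n → Set
OnFourCycle H v = ∃[ a ] ∃[ b ] ∃[ c ]
  (Unique (v ∷ a ∷ b ∷ c ∷ []) × H v a × H a b × H b c × H c v)

-- a 2-factor each of whose components is a 4-cycle
-- (in a 2-regular graph the component of v is a cycle, which is a 4-cycle
--  iff v lies on a 4-cycle of H)
FourCycleTwoFactor : ∀ {n} → Graph n → Set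
FourCycleTwoFactor {n} H = TwoFactor H × (∀ (v : Fin n) → OnFourCycle H v)

Connected : ∀ {n} → Graph n → Set
Connected {n} G = ∀ (u v : Fin n) → Star G u v

HasCycle : ∀ {n} → Graph n → Set
HasCycle {n} G = ∃[ x ] Σ (List (Fin n)) λ rest →
  2 ≤ length rest × Unique (x ∷ rest) × Linked G (x ∷ rest ++ x ∷ [])

SpanningTree : ∀ {n} → Graph n → Set
SpanningTree G = Connected G × ¬ HasCycle G

Multicoloured : ∀ {n k} → Colouring n k → Graph n → Set
Multicoloured {n} μ G = ∀ (u v x y : Fin n) → G u v → G x y → μ u v ≡ μ x y →
  (u ≡ x × v ≡ y) ⊎ (u ≡ y × v ≡ x)

Isomorphic : ∀ {n} → Graph n → Graph n → Set
Isomorphic {n} G H = Σ (Fin n ↔ Fin n) λ σ →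
  ∀ (u v : Fin n) → (G u v → H (Inverse.to σ u) (Inverse.to σ v))
                  × (H (Inverse.to σ u) (Inverse.to σ v) → G u v)

-- partition of the edges of K_n into t classes: a symmetric class assignment
-- τ on the pairs; class i is the graph of edges uv (u ≠ v) with τ u v ≡ i
ClassGraph : ∀ {n t} → (Fin n → Fin n → Fin t) → Fin t → Graph n
ClassGraph τ i u v = u ≢ v × τ u v ≡ i

{-# OPTIONS --safe #-}

-- The colouring is x + y on 𝔽₂ⁿ up to names: for colours c ≠ d, the 4-cycles say that following an
-- edge of colour c commutes with following one of colour d, so colours act as translations.  Hence
-- 2m = 2ⁿ with n ≥ 3.  For n = 3 the trees are given explicitly.  To pass from n to n + 1, put each
-- tree into each half of the vertices and hang a leaf of the other half on every vertex of the copy;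
-- the new edges of a tree must form a transversal of the Latin square x + y, and an orthomorphism of
-- 𝔽₂ⁿ partitions that square into transversals.

module Submission where

open import Defs
open import Data.Bool using (Bool; true; false; not; _xor_; if_then_else_)
open import Data.Bool.Properties using (xor-assoc; xor-comm; xor-same)
import Data.Bool.Properties as Bool
open import Data.Fin using (Fin; zero; suc)
open import Data.Fin.Properties using (all?; ¬∀⟶∃¬; injective⇒≤; *↔×; 2↔Bool; punchInᵢ≢i)
import Data.Fin.Properties as Fin
open import Data.Fin.Permutation using (↔⇒≡)
open import Data.List using ([]; _∷_; _++_)
open import Data.List.Membership.Propositional using (_∈_)
open import Data.List.Relation.Unary.All using (All; []; _∷_; lookup)
open import Data.List.Relation.Unary.AllPairs using ([]; _∷_)
open import Data.List.Relation.Unary.Any using (here; there)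
open import Data.List.Relation.Unary.Linked using (_∷_; Linked)
open import Data.List.Relation.Unary.Unique.Propositional using (Unique)
open import Data.Nat using (ℕ; zero; suc; _+_; _*_; _∸_; _^_; _≤_; _<_; z≤n; s≤s)
import Data.Nat as ℕ
open import Data.Nat.Induction using (<-wellFounded)
open import Data.Nat.Properties using (≤-trans; <-trans; <-irrefl; ≤-refl; ≤-reflexive; +-suc; +-mono-≤; +-identityʳ; m^n>0; *-cancelˡ-≡; <⇒≱)
open import Data.Product using (Σ; _×_; ∃; ∃-syntax; _,_; proj₁; proj₂; uncurry)
open import Data.Product.Function.NonDependent.Propositional using (_×-↔_)
open import Data.Sum using (_⊎_; inj₁; inj₂; swap)
import Data.Sum as Sum
open import Data.Vec using (Vec; []; _∷_; zipWith; replicate; head; tail) renaming (_++_ to _++ᵛ_)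
open import Data.Vec.Properties using (zipWith-assoc; zipWith-comm; zipWith-identityˡ; ≡-dec; ∷-injectiveʳ)
open import Function using (_∘_)
open import Function.Bundles using (_↔_; mk↔ₛ′; Inverse)
open import Function.Properties.Inverse using (↔-sym; ↔-trans)
open import Induction.WellFounded using (Acc; acc)
open import Relation.Binary.Construct.Closure.ReflexiveTransitive using (Star; ε; _◅_; _◅◅_)
open import Relation.Binary.PropositionalEquality using (_≡_; _≢_; refl; sym; trans; cong; cong₂; subst; ≢-sym; module ≡-Reasoning)
open import Relation.Nullary using (¬_; Dec; yes; no; contradiction)
open import Relation.Nullary.Decidable using (map′; ¬?; _⊎-dec_; _→-dec_; decidable-stable; from-yes)
open import Relation.Unary using (Decidable)

open Inverse using (to; from; strictlyInverseˡ; strictlyInverseʳ)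

↔-injective : ∀ {A B : Set} (f : A ↔ B) {x y} → to f x ≡ to f y → x ≡ y
↔-injective f eq = trans (sym (strictlyInverseʳ f _)) (trans (cong (from f) eq) (strictlyInverseʳ f _))

-- Groups of exponent two

record IsBooleanGroup {A : Set} (_∙_ : A → A → A) (e : A) : Set where
  field
    assoc     : ∀ x y z → (x ∙ y) ∙ z ≡ x ∙ (y ∙ z)
    comm      : ∀ x y → x ∙ y ≡ y ∙ x
    identityˡ : ∀ x → e ∙ x ≡ x
    square    : ∀ x → x ∙ x ≡ e

  cancelˡ : ∀ x y → x ∙ (x ∙ y) ≡ y
  cancelˡ x y = trans (sym (assoc x x y)) (trans (cong (_∙ y) (square x)) (identityˡ y))

  cancelʳ : ∀ x y → (x ∙ y) ∙ y ≡ x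
  cancelʳ x y = trans (comm (x ∙ y) y) (trans (cong (y ∙_) (comm x y)) (cancelˡ y x))

  conjugate : ∀ x y → x ∙ (y ∙ x) ≡ y
  conjugate x y = trans (cong (x ∙_) (comm y x)) (cancelˡ x y)

  cancelˡ-injective : ∀ x {y z} → x ∙ y ≡ x ∙ z → y ≡ z
  cancelˡ-injective x eq = trans (sym (cancelˡ x _)) (trans (cong (x ∙_) eq) (cancelˡ x _))

  cancelʳ-injective : ∀ x {y z} → y ∙ x ≡ z ∙ x → y ≡ z
  cancelʳ-injective x eq = trans (sym (cancelʳ _ x)) (trans (cong (_∙ x) eq) (cancelʳ _ x))

  ∙≡e⇒≡ : ∀ {x y} → x ∙ y ≡ e → x ≡ y
  ∙≡e⇒≡ {x} eq = sym (cancelˡ-injective x (trans eq (sym (square x))))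

  rotate : ∀ x y z → (x ∙ y) ∙ z ≡ (x ∙ z) ∙ y
  rotate x y z = trans (assoc x y z) (trans (cong (x ∙_) (comm y z)) (sym (assoc x z y)))

-- The elementary abelian 2-group of bit vectors

Bits : ℕ → Set
Bits = Vec Bool

infixl 6 _⊕_

_⊕_ : ∀ {k} → Bits k → Bits k → Bits k
_⊕_ = zipWith _xor_

𝟎 : ∀ {k} → Bits k
𝟎 = replicate _ false

⊕-isBooleanGroup : ∀ k → IsBooleanGroup {Bits k} _⊕_ 𝟎
⊕-isBooleanGroup k = record
  { assoc     = zipWith-assoc xor-assoc
  ; comm      = zipWith-comm xor-comm
  ; identityˡ = zipWith-identityˡ (λ _ → refl)
  ; square    = square
  }
  where
  square : ∀ {k} (x : Bits k) → x ⊕ x ≡ 𝟎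
  square []      = refl
  square (b ∷ x) = cong₂ _∷_ (xor-same b) (square x)

module ⊕ {k} = IsBooleanGroup (⊕-isBooleanGroup k)

infix 4 _≟_

_≟_ : ∀ {k} (x y : Bits k) → Dec (x ≡ y)
_≟_ = ≡-dec Bool._≟_

anyBits? : ∀ {k} {P : Bits k → Set} → Decidable P → Dec (∃ P)
anyBits? {zero}  P? = map′ ([] ,_) (λ { ([] , p) → p }) (P? [])
anyBits? {suc k} P? = map′
  (λ { (inj₁ (x , p)) → false ∷ x , p ; (inj₂ (x , p)) → true ∷ x , p })
  (λ { (false ∷ x , p) → inj₁ (x , p) ; (true ∷ x , p) → inj₂ (x , p) })
  (anyBits? (P? ∘ (false ∷_)) ⊎-dec anyBits? (P? ∘ (true ∷_)))

allBits? : ∀ {k} {P : Bits k → Set} → Decidable P → Dec (∀ x → P x)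
allBits? P? = map′
  (λ ¬∃ x → decidable-stable (P? x) (λ ¬p → ¬∃ (x , ¬p)))
  (λ ∀P (x , ¬p) → ¬p (∀P x))
  (¬? (anyBits? (¬? ∘ P?)))

Bits↔Fin : ∀ k → Bits k ↔ Fin (2 ^ k)
Bits↔Fin zero    = mk↔ₛ′ (λ _ → zero) (λ _ → []) (λ { zero → refl }) (λ { [] → refl })
Bits↔Fin (suc k) = ↔-trans ∷↔× (↔-trans (↔-sym 2↔Bool ×-↔ Bits↔Fin k) (↔-sym *↔×))
  where
  ∷↔× : Bits (suc k) ↔ (Bool × Bits k)
  ∷↔× = mk↔ₛ′ (λ x → head x , tail x) (uncurry _∷_) (λ _ → refl) (λ { (_ ∷ _) → refl })

n<2^n : ∀ n → n < 2 ^ n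
n<2^n zero    = s≤s z≤n
n<2^n (suc n) = +-mono-≤ (m^n>0 2 n) (≤-trans (n<2^n n) (≤-reflexive (sym (+-identityʳ _))))

-- Coordinates on a finite Boolean group

module Coordinates {n} {_∙_ : Fin n → Fin n → Fin n} {e} (G : IsBooleanGroup _∙_ e) where

  open IsBooleanGroup G

  record Embedding (k : ℕ) : Set where
    field
      embed     : Bits k → Fin n
      homo      : ∀ x y → embed (x ⊕ y) ≡ embed x ∙ embed y
      injective : ∀ {x y} → embed x ≡ embed y → x ≡ y

  open Embedding

  Coordinatisation : Set
  Coordinatisation = ∃[ k ] Σ (Bits k ↔ Fin n) λ φ → ∀ x y → to φ (x ⊕ y) ≡ to φ x ∙ to φ y

  trivial : Embedding 0
  trivial = record
    { embed = λ _ → e ; homo = λ _ _ → sym (square e) ; injective = λ { {[]} {[]} _ → refl } }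

  -- Injectivity makes 2^k at most `n`, and k < 2^k.
  bounded : ∀ {k} → Embedding k → k < n
  bounded {k} E = ≤-trans (n<2^n k) (injective⇒≤ {f = embed E ∘ from (Bits↔Fin k)}
    (↔-injective (↔-sym (Bits↔Fin k)) ∘ injective E))

  -- Adjoins `v` as a generator: the image becomes the old subgroup together with its coset by `v`,
  -- and the two are disjoint because `v` lies outside the subgroup.
  extend : ∀ {k} (E : Embedding k) v → (∀ x → embed E x ≢ v) → Embedding (suc k)
  extend {k} E v v∉E = record { embed = φ ; homo = φ-homo ; injective = λ {x} {y} → φ-injective x y }
    where
    φ : Bits (suc k) → Fin n
    φ (false ∷ x) = embed E x
    φ (true  ∷ x) = v ∙ embed E x

    φ-homo : ∀ x y → φ (x ⊕ y) ≡ φ x ∙ φ y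
    φ-homo (false ∷ x) (false ∷ y) = homo E x y
    φ-homo (true  ∷ x) (false ∷ y) = trans (cong (v ∙_) (homo E x y)) (sym (assoc _ _ _))
    φ-homo (false ∷ x) (true  ∷ y) = begin
      v ∙ embed E (x ⊕ y)         ≡⟨ cong (v ∙_) (homo E x y) ⟩
      v ∙ (embed E x ∙ embed E y) ≡⟨ sym (assoc _ _ _) ⟩
      (v ∙ embed E x) ∙ embed E y ≡⟨ cong (_∙ embed E y) (comm _ _) ⟩
      (embed E x ∙ v) ∙ embed E y ≡⟨ assoc _ _ _ ⟩
      embed E x ∙ (v ∙ embed E y) ∎
      where open ≡-Reasoning
    φ-homo (true  ∷ x) (true  ∷ y) = begin
      embed E (x ⊕ y)                   ≡⟨ homo E x y ⟩
      embed E x ∙ embed E y             ≡⟨ cong (_∙ embed E y) (sym (conjugate v _)) ⟩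
      (v ∙ (embed E x ∙ v)) ∙ embed E y ≡⟨ cong (_∙ embed E y) (sym (assoc _ _ _)) ⟩
      ((v ∙ embed E x) ∙ v) ∙ embed E y ≡⟨ assoc _ _ _ ⟩
      (v ∙ embed E x) ∙ (v ∙ embed E y) ∎
      where open ≡-Reasoning

    disjoint : ∀ x y → embed E x ≢ v ∙ embed E y
    disjoint x y eq = v∉E (x ⊕ y)
      (trans (homo E x y) (trans (cong (_∙ embed E y) eq) (cancelʳ v _)))

    φ-injective : ∀ x y → φ x ≡ φ y → x ≡ y
    φ-injective (false ∷ x) (false ∷ y) eq = cong (false ∷_) (injective E eq)
    φ-injective (true  ∷ x) (true  ∷ y) eq = cong (true ∷_) (injective E (cancelˡ-injective v eq))
    φ-injective (false ∷ x) (true  ∷ y) eq = contradiction eq (disjoint x y)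
    φ-injective (true  ∷ x) (false ∷ y) eq = contradiction (sym eq) (disjoint y x)

  -- Each extension trades one unit of `fuel` for one dimension, so running out would mean n ≤ k,
  -- against `bounded`.
  grow : ∀ fuel {k} → n ≤ fuel + k → Embedding k → Coordinatisation
  grow zero       n≤k E = contradiction n≤k (<⇒≱ (bounded E))
  grow (suc fuel) {k} n≤ E with all? (λ v → anyBits? (λ x → embed E x Fin.≟ v))
  ... | yes onto = k , mk↔ₛ′ (embed E) (proj₁ ∘ onto) (proj₂ ∘ onto) (λ x → injective E (proj₂ (onto _))) , homo E
  ... | no ¬onto with ¬∀⟶∃¬ n _ (λ v → anyBits? (λ x → embed E x Fin.≟ v)) ¬onto
  ...   | v , v∉E = grow fuel (≤-trans n≤ (≤-reflexive (sym (+-suc fuel k))))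
                         (extend E v (λ x eq → v∉E (x , eq)))

  coordinates : Coordinatisation
  coordinates = grow n (≤-reflexive (sym (+-identityʳ n))) trivial

-- The translation group of a colouring

module Translations {n k} (μ : Colouring (suc n) (suc (suc k))) (μ-sym : Symmetric μ) (proper : Proper μ)
  (fourCycles : ∀ c d → c ≢ d → FourCycleTwoFactor (TwoColourGraph μ c d)) where

  proper-unique : ∀ {u v w} → u ≢ v → u ≢ w → μ u v ≡ μ u w → v ≡ w
  proper-unique {u} {v} {w} u≢v u≢w eq with v Fin.≟ w
  ... | yes v≡w = v≡w
  ... | no  v≢w = contradiction eq (proper u v w u≢v u≢w v≢w)

  -- A 4-cycle v, a, b, f normalised so that its colours alternate c, d, c, d from the edge `va` on.
  record Square (c d : Fin (suc (suc k))) (v : Fin (suc n)) : Set where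
    field
      {a b f} : Fin (suc n)
      v≢a : v ≢ a
      v≢f : v ≢ f
      a≢b : a ≢ b
      f≢b : f ≢ b
      va  : μ v a ≡ c
      vf  : μ v f ≡ d
      ab  : μ a b ≡ d
      fb  : μ f b ≡ c

  reflect : ∀ {c d v} → Square c d v → Square d c v
  reflect s = record { v≢a = v≢f ; v≢f = v≢a ; a≢b = f≢b ; f≢b = a≢b ; va = vf ; vf = va ; ab = fb ; fb = ab }
    where open Square s

  second : ∀ {c d x y : Fin (suc (suc k))} → x ≡ c → y ≢ x → y ≡ c ⊎ y ≡ d → y ≡ d
  second x≡c y≢x (inj₁ y≡c) = contradiction (trans y≡c (sym x≡c)) y≢x
  second x≡c y≢x (inj₂ y≡d) = y≡d

  -- Properness forces the alternation: consecutive edges differ in colour and only two colours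
  -- occur, so the colour of `va` fixes the others.
  mkSquare : ∀ {c d v a b f} → v ≢ a → v ≢ f → a ≢ b → f ≢ b → v ≢ b → a ≢ f →
    μ v a ≡ c → μ a b ≡ c ⊎ μ a b ≡ d → μ b f ≡ c ⊎ μ b f ≡ d → μ f v ≡ c ⊎ μ f v ≡ d → Square c d v
  mkSquare {v = v} {a} {b} {f} v≢a v≢f a≢b f≢b v≢b a≢f va ab bf fv = record
    { v≢a = v≢a ; v≢f = v≢f ; a≢b = a≢b ; f≢b = f≢b ; va = va
    ; vf = trans (μ-sym v f) fv′
    ; ab = second va (λ eq → proper a b v a≢b (≢-sym v≢a) (≢-sym v≢b) (trans eq (μ-sym v a))) ab
    ; fb = trans (μ-sym f b) (second fv′
             (λ eq → proper f b v f≢b (≢-sym v≢f) (≢-sym v≢b) (trans (μ-sym f b) eq)) (swap bf))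
    }
    where fv′ = second va (λ eq → proper v f a v≢f v≢a (≢-sym a≢f) (trans (μ-sym v f) eq)) fv

  square : ∀ {c d} → c ≢ d → ∀ v → Square c d v
  square {c} {d} c≢d v with proj₂ (fourCycles c d c≢d) v
  ... | a , b , f , ((v≢a ∷ v≢b ∷ v≢f ∷ []) ∷ (a≢b ∷ a≢f ∷ []) ∷ (b≢f ∷ []) ∷ _)
      , (_ , va) , (_ , ab) , (_ , bf) , (_ , fv) with va
  ...   | inj₁ va≡c = mkSquare v≢a v≢f a≢b (≢-sym b≢f) v≢b a≢f va≡c ab bf fv
  ...   | inj₂ va≡d =
    reflect (mkSquare v≢a v≢f a≢b (≢-sym b≢f) v≢b a≢f va≡d (swap ab) (swap bf) (swap fv))

  -- Each colour is a perfect matching and so acts on the vertices. The second colour of the square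
  -- is an arbitrary one other than `c`; only the edge of colour `c` is kept.
  neighbour : Fin (suc (suc k)) → Fin (suc n) → Fin (suc n)
  neighbour c v = Square.a (square (≢-sym (punchInᵢ≢i c zero)) v)

  neighbour-≢ : ∀ c v → v ≢ neighbour c v
  neighbour-≢ c v = Square.v≢a (square (≢-sym (punchInᵢ≢i c zero)) v)

  neighbour-colour : ∀ c v → μ v (neighbour c v) ≡ c
  neighbour-colour c v = Square.va (square (≢-sym (punchInᵢ≢i c zero)) v)

  neighbour-unique : ∀ {c v w} → v ≢ w → μ v w ≡ c → w ≡ neighbour c v
  neighbour-unique {c} {v} v≢w eq =
    proper-unique v≢w (neighbour-≢ c v) (trans eq (sym (neighbour-colour c v)))

  -- Both routes from `v` end at `b`, the corner opposite to `v` in the square of the two colours.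
  neighbour-comm : ∀ c d v → neighbour c (neighbour d v) ≡ neighbour d (neighbour c v)
  neighbour-comm c d v with c Fin.≟ d
  ... | yes refl = refl
  ... | no  c≢d  = begin
    neighbour c (neighbour d v) ≡⟨ cong (neighbour c) (sym (neighbour-unique (v≢f s) (vf s))) ⟩
    neighbour c (f s)           ≡⟨ sym (neighbour-unique (f≢b s) (fb s)) ⟩
    b s                         ≡⟨ neighbour-unique (a≢b s) (ab s) ⟩
    neighbour d (a s)           ≡⟨ cong (neighbour d) (neighbour-unique (v≢a s) (va s)) ⟩
    neighbour d (neighbour c v) ∎
    where
    open ≡-Reasoning
    open Square
    s = square c≢d v

  infixr 7 _∙_

  -- A vertex is identified with the colour translation that carries `zero` to it; `zero` itself
  -- stands for the identity.
  _∙_ : Fin (suc n) → Fin (suc n) → Fin (suc n)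
  zero  ∙ v = v
  suc u ∙ v = neighbour (μ zero (suc u)) v

  identityʳ : ∀ u → u ∙ zero ≡ u
  identityʳ zero    = refl
  identityʳ (suc u) = sym (neighbour-unique (λ ()) refl)

  exchange : ∀ u v w → u ∙ v ∙ w ≡ v ∙ u ∙ w
  exchange zero    v       w = refl
  exchange (suc u) zero    w = refl
  exchange (suc u) (suc v) w = neighbour-comm _ _ w

  -- The translations by `u` and `v` commute, and applied to `zero` their two composites are the two
  -- products.
  comm : ∀ u v → u ∙ v ≡ v ∙ u
  comm u v = begin
    u ∙ v        ≡⟨ cong (u ∙_) (sym (identityʳ v)) ⟩
    u ∙ v ∙ zero ≡⟨ exchange u v zero ⟩
    v ∙ u ∙ zero ≡⟨ cong (v ∙_) (identityʳ u) ⟩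
    v ∙ u        ∎
    where open ≡-Reasoning

  isBooleanGroup : IsBooleanGroup _∙_ zero
  isBooleanGroup = record
    { assoc     = λ u v w → trans (comm (u ∙ v) w)
                              (trans (exchange w u v) (cong (u ∙_) (comm w v)))
    ; comm      = comm
    ; identityˡ = λ _ → refl
    ; square    = λ { zero → refl ; (suc u) → sym (neighbour-unique (λ ()) (μ-sym (suc u) zero)) }
    }

  open IsBooleanGroup isBooleanGroup using (conjugate; ∙≡e⇒≡)

  ∙-neighbour : ∀ {u} v → zero ≢ u → u ∙ v ≡ neighbour (μ zero u) v
  ∙-neighbour {zero}  v 0≢u = contradiction refl 0≢u
  ∙-neighbour {suc u} v _   = refl

  -- Let `a` be joined to `zero` by the colour of `uv`. Translation by `a` carries `u` to `v`, hence
  -- `a` is `u ∙ v`.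
  colour-∙ : ∀ {u v} → u ≢ v → μ u v ≡ μ zero (u ∙ v)
  colour-∙ {u} {v} u≢v = begin
    c              ≡⟨ sym (neighbour-colour c zero) ⟩
    μ zero a       ≡⟨ cong (μ zero) (sym (conjugate u a)) ⟩
    μ zero (u ∙ a ∙ u) ≡⟨ cong (λ x → μ zero (u ∙ x)) a∙u≡v ⟩
    μ zero (u ∙ v) ∎
    where
    open ≡-Reasoning
    c = μ u v
    a = neighbour c zero
    a∙u≡v : a ∙ u ≡ v
    a∙u≡v = trans (∙-neighbour u (neighbour-≢ c zero))
      (trans (cong (λ x → neighbour x u) (neighbour-colour c zero)) (sym (neighbour-unique u≢v refl)))

  colour-determines-∙ : ∀ {u v x y} → u ≢ v → x ≢ y → μ u v ≡ μ x y → u ∙ v ≡ x ∙ y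
  colour-determines-∙ u≢v x≢y eq = proper-unique (u≢v ∘ ∙≡e⇒≡ ∘ sym) (x≢y ∘ ∙≡e⇒≡ ∘ sym)
    (trans (sym (colour-∙ u≢v)) (trans eq (colour-∙ x≢y)))

-- Rooted trees given by a parent map with a height function

Adjacent : {A : Set} → (A → A) → A → A → Set
Adjacent p x y = p x ≡ y ⊎ p y ≡ x

module ParentMap {n} (G : Graph n) (parent : Fin n → Fin n) (height : Fin n → ℕ)
  (edge-to-parent : ∀ u → parent u ≢ u → G u (parent u) × G (parent u) u)
  (edge⇒adjacent : ∀ {u v} → G u v → u ≢ v × Adjacent parent u v)
  (descending : ∀ u → parent u ≢ u → height (parent u) < height u)
  (root-unique : ∀ {u v} → parent u ≡ u → parent v ≡ v → u ≡ v)
  where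

  path-to-root : ∀ u → Acc _<_ (height u) → ∃[ r ] (parent r ≡ r × Star G u r × Star G r u)
  path-to-root u (acc rec) with parent u Fin.≟ u
  ... | yes root = u , root , ε , ε
  ... | no ¬root with path-to-root (parent u) (rec (descending u ¬root)) | edge-to-parent u ¬root
  ...   | r , root , up , down | u→p , p→u = r , root , u→p ◅ up , down ◅◅ p→u ◅ ε

  connected : Connected G
  connected u v with path-to-root u (<-wellFounded _) | path-to-root v (<-wellFounded _)
  ... | r , root , up , _ | s , root′ , _ , down with root-unique root root′
  ...   | refl = up ◅◅ down

  data Step (u v : Fin n) : Set where
    up   : parent u ≡ v → height v < height u → Step u v
    down : parent v ≡ u → height u < height v → Step u v

  step : ∀ {u v} → G u v → Step u v
  step {u} {v} g with edge⇒adjacent g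
  ... | u≢v , inj₁ refl = up refl (descending u (≢-sym u≢v))
  ... | u≢v , inj₂ refl = down refl (descending v u≢v)

  -- A walk that does not backtrack keeps descending once it has made a downward step,
  -- so it cannot close up.
  descend : ∀ {a b z} l → parent b ≡ a → Unique (a ∷ b ∷ l) → All (z ≢_) (a ∷ b ∷ l) →
    Linked G (b ∷ l ++ z ∷ []) → height b < height z × parent z ∈ b ∷ l
  descend [] refl _ (z≢a ∷ _) (g ∷ _) with step g
  ... | up   a≡z _   = contradiction (sym a≡z) z≢a
  ... | down pz≡b lt = lt , here pz≡b
  descend (c ∷ l) refl ((_ ∷ a≢c ∷ _) ∷ b∷l!) (_ ∷ z∉) (g ∷ gs) with step g
  ... | up   a≡c _   = contradiction a≡c a≢c
  ... | down pc≡b lt with descend l pc≡b b∷l! z∉ gs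
  ...   | lt′ , pz∈ = <-trans lt lt′ , there pz∈

  -- A downward step anywhere would, by `descend`, put `parent z` on the rest of the walk, which is
  -- excluded; so the walk climbs all the way to `z`.
  climb : ∀ {b z} l → Unique (b ∷ l) → All (z ≢_) (b ∷ l) → All (parent z ≢_) (b ∷ l) →
    Linked G (b ∷ l ++ z ∷ []) → height z < height b
  climb [] _ _ (pz≢b ∷ []) (g ∷ _) with step g
  ... | up   _ lt   = lt
  ... | down pz≡b _ = contradiction pz≡b pz≢b
  climb (c ∷ l) b∷l! z∉ (_ ∷ pz∉) (g ∷ gs) with step g
  ... | down pc≡b _ = contradiction refl (lookup pz∉ (proj₂ (descend l pc≡b b∷l! z∉ gs)))
  climb (c ∷ l) (_ ∷ l!) (_ ∷ z∉) (_ ∷ pz∉) (g ∷ gs) | up _ lt = <-trans (climb l l! z∉ pz∉ gs) lt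

  -- Split by the directions of the first two steps z, b, c. Down-up makes both `z` and `c` the
  -- parent of `b`; down-down makes the heights rise around the cycle; up-down makes it revisit `b`,
  -- the parent of `z`; up-up makes the heights fall around it.
  acyclic : ¬ HasCycle G
  acyclic (z , [] , () , _)
  acyclic (z , _ ∷ [] , s≤s () , _)
  acyclic (z , b ∷ c ∷ l , _ , (z∉@(_ ∷ z≢c ∷ _) ∷ b∷c∷l!) , g ∷ h ∷ gs) with step g | step h
  ... | down refl _  | up z≡c _     = contradiction z≡c z≢c
  ... | down _ z<b   | down pc≡b b<c =
    <-irrefl refl (<-trans z<b (<-trans b<c (proj₁ (descend l pc≡b b∷c∷l! z∉ gs))))
  ... | up pz≡b _    | down pc≡b _  with b∷c∷l!
  ...   | b∉ ∷ _ = contradiction (sym pz≡b) (lookup b∉ (proj₂ (descend l pc≡b b∷c∷l! z∉ gs)))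
  acyclic (z , b ∷ c ∷ l , _ , ((_ ∷ z∉) ∷ (b∉ ∷ c∷l!)) , g ∷ h ∷ gs) | up refl b<z | up _ c<b =
    <-irrefl refl (<-trans (climb l c∷l! z∉ b∉ gs) (<-trans c<b b<z))

  spanningTree : SpanningTree G
  spanningTree = connected , acyclic

-- Partitions into rainbow trees for the colouring x ⊕ y

-- The trees are the images σ i of one rooted tree, whose root is the fixed point of the parent map.
-- Since only the root has edge label 𝟎, rainbow covers both distinctness of colours and uniqueness
-- of the root.
record TreePartition (n : ℕ) : Set where
  field
    parent     : Bits (suc n) → Bits (suc n)
    height     : Bits (suc n) → ℕ
    descending : ∀ v → parent v ≢ v → height (parent v) < height v
    σ          : Bits n → Bits (suc n) ↔ Bits (suc n)
    class      : Bits (suc n) → Bits (suc n) → Bits n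
    class-sym  : ∀ u v → class u v ≡ class v u
    rainbow    : ∀ i {u v} → to (σ i) u ⊕ to (σ i) (parent u) ≡ to (σ i) v ⊕ to (σ i) (parent v) → u ≡ v
    sound      : ∀ i v → parent v ≢ v → class (to (σ i) v) (to (σ i) (parent v)) ≡ i
    complete   : ∀ u v → u ≢ v → let i = class u v in Adjacent parent (from (σ i) u) (from (σ i) v)

-- Orthomorphisms of bit vectors

record Orthomorphism (n : ℕ) : Set where
  field
    bijection : Bits n ↔ Bits n
    -- The map y ↦ f y ⊕ y has to be a bijection too; on a finite set a left inverse says so.
    recover   : Bits n → Bits n
    recovers  : ∀ y → recover (to bijection y ⊕ y) ≡ y

-- Blocks of size 2 and 3, the companion matrices of irreducible polynomials over 𝔽₂.

block₂ : Orthomorphism 2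
block₂ = record
  { bijection = mk↔ₛ′ f g (from-yes (allBits? λ x → f (g x) ≟ x)) (from-yes (allBits? λ x → g (f x) ≟ x))
  ; recover   = h
  ; recovers  = from-yes (allBits? λ x → h (f x ⊕ x) ≟ x)
  }
  where
  f g h : Bits 2 → Bits 2
  f (a ∷ b ∷ []) = b ∷ (a xor b) ∷ []
  g (a ∷ b ∷ []) = (a xor b) ∷ a ∷ []
  -- Here f + 1 = f² and f³ = 1, so `h` repeats `f`.
  h (a ∷ b ∷ []) = b ∷ (a xor b) ∷ []

block₃ : Orthomorphism 3
block₃ = record
  { bijection = mk↔ₛ′ f g (from-yes (allBits? λ x → f (g x) ≟ x)) (from-yes (allBits? λ x → g (f x) ≟ x))
  ; recover   = h
  ; recovers  = from-yes (allBits? λ x → h (f x ⊕ x) ≟ x)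
  }
  where
  f g h : Bits 3 → Bits 3
  f (a ∷ b ∷ c ∷ []) = b ∷ c ∷ (a xor b) ∷ []
  g (a ∷ b ∷ c ∷ []) = (c xor a) ∷ a ∷ b ∷ []
  -- Here f + 1 = f³ and f has order 7, so `h` is f⁴ = f² + f.
  h (a ∷ b ∷ c ∷ []) = (b xor c) ∷ (a xor b xor c) ∷ (a xor c) ∷ []

-- Every dimension from 2 on is a sum of 2s and at most one 3, and both conditions hold blockwise in
-- a direct sum.
orthomorphism : ∀ n → Orthomorphism (2 + n)
orthomorphism 0             = block₂
orthomorphism 1             = block₃
orthomorphism (suc (suc n)) = record
  { bijection = mk↔ₛ′ f g
      (λ { (a ∷ b ∷ x) → cong₂ _++ᵛ_ (strictlyInverseˡ B.bijection (a ∷ b ∷ [])) (strictlyInverseˡ R.bijection x) })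
      (λ { (a ∷ b ∷ x) → cong₂ _++ᵛ_ (strictlyInverseʳ B.bijection (a ∷ b ∷ [])) (strictlyInverseʳ R.bijection x) })
  ; recover   = h
  ; recovers  = λ { (a ∷ b ∷ x) → cong₂ _++ᵛ_ (B.recovers (a ∷ b ∷ [])) (R.recovers x) }
  }
  where
  module B = Orthomorphism block₂
  module R = Orthomorphism (orthomorphism n)
  f g h : Bits (4 + n) → Bits (4 + n)
  f (a ∷ b ∷ x) = to B.bijection (a ∷ b ∷ []) ++ᵛ to R.bijection x
  g (a ∷ b ∷ x) = from B.bijection (a ∷ b ∷ []) ++ᵛ from R.bijection x
  h (a ∷ b ∷ x) = B.recover (a ∷ b ∷ []) ++ᵛ R.recover x

-- Trees on 8 vertices

module K₈ where

  pattern O = false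
  pattern I = true

  -- The labels `v ⊕ parent v` of the seven edges run through all nonzero vectors.
  parent : Bits 3 → Bits 3
  parent (O ∷ O ∷ O ∷ []) = O ∷ O ∷ O ∷ []
  parent (I ∷ O ∷ O ∷ []) = O ∷ I ∷ I ∷ []
  parent (O ∷ I ∷ O ∷ []) = I ∷ I ∷ O ∷ []
  parent (I ∷ I ∷ O ∷ []) = O ∷ O ∷ O ∷ []
  parent (O ∷ O ∷ I ∷ []) = O ∷ O ∷ O ∷ []
  parent (I ∷ O ∷ I ∷ []) = O ∷ O ∷ O ∷ []
  parent (O ∷ I ∷ I ∷ []) = O ∷ O ∷ I ∷ []
  parent (I ∷ I ∷ I ∷ []) = I ∷ O ∷ O ∷ []

  height : Bits 3 → ℕ
  height (O ∷ O ∷ O ∷ []) = 0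
  height (I ∷ O ∷ O ∷ []) = 3
  height (O ∷ I ∷ O ∷ []) = 2
  height (I ∷ I ∷ O ∷ []) = 1
  height (O ∷ O ∷ I ∷ []) = 1
  height (I ∷ O ∷ I ∷ []) = 1
  height (O ∷ I ∷ I ∷ []) = 2
  height (I ∷ I ∷ I ∷ []) = 4

  infixr 8 _·_

  _·_ : Bool → Bits 3 → Bits 3
  b · x = if b then x else 𝟎

  -- An affine bijection acts on edge labels through its linear part, so it keeps a rainbow tree
  -- rainbow.
  affine : (a b c t : Bits 3) → Bits 3 → Bits 3
  affine a b c t (x ∷ y ∷ z ∷ []) = x · a ⊕ y · b ⊕ z · c ⊕ t

  -- Found by a computer search over the rainbow spanning trees and the affine maps.
  f g : Bits 2 → Bits 3 → Bits 3
  f (O ∷ O ∷ []) = affine (I ∷ O ∷ O ∷ []) (O ∷ I ∷ O ∷ []) (O ∷ O ∷ I ∷ []) (O ∷ O ∷ O ∷ [])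
  f (O ∷ I ∷ []) = affine (I ∷ O ∷ O ∷ []) (O ∷ I ∷ I ∷ []) (I ∷ O ∷ I ∷ []) (I ∷ I ∷ O ∷ [])
  f (I ∷ O ∷ []) = affine (O ∷ O ∷ I ∷ []) (I ∷ I ∷ O ∷ []) (O ∷ I ∷ O ∷ []) (I ∷ O ∷ I ∷ [])
  f (I ∷ I ∷ []) = affine (O ∷ I ∷ I ∷ []) (I ∷ I ∷ O ∷ []) (I ∷ O ∷ O ∷ []) (I ∷ I ∷ I ∷ [])
  g (O ∷ O ∷ []) = affine (I ∷ O ∷ O ∷ []) (O ∷ I ∷ O ∷ []) (O ∷ O ∷ I ∷ []) (O ∷ O ∷ O ∷ [])
  g (O ∷ I ∷ []) = affine (I ∷ O ∷ O ∷ []) (I ∷ I ∷ I ∷ []) (I ∷ O ∷ I ∷ []) (O ∷ I ∷ I ∷ [])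
  g (I ∷ O ∷ []) = affine (O ∷ I ∷ I ∷ []) (O ∷ O ∷ I ∷ []) (I ∷ O ∷ O ∷ []) (I ∷ I ∷ I ∷ [])
  g (I ∷ I ∷ []) = affine (O ∷ O ∷ I ∷ []) (O ∷ I ∷ I ∷ []) (I ∷ I ∷ I ∷ []) (I ∷ O ∷ I ∷ [])

  σ : Bits 2 → Bits 3 ↔ Bits 3
  σ i = mk↔ₛ′ (f i) (g i)
    -- The check ranges over every index and is applied to `i` afterwards, since only a closed
    -- decision evaluates to `yes`.
    (from-yes (allBits? λ i → allBits? λ x → f i (g i x) ≟ x) i)
    (from-yes (allBits? λ i → allBits? λ x → g i (f i x) ≟ x) i)

  adjacent? : ∀ u v i → Dec (Adjacent parent (g i u) (g i v))
  adjacent? u v i = (parent (g i u) ≟ g i v) ⊎-dec (parent (g i v) ≟ g i u)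

  class : Bits 3 → Bits 3 → Bits 2
  class u v with anyBits? (adjacent? u v)
  ... | yes (i , _) = i
  -- Every pair of distinct vertices lies in some tree, so this default can occur only on the
  -- diagonal.
  ... | no _        = 𝟎

  treePartition : TreePartition 2
  treePartition = record
    { parent     = parent
    ; height     = height
    ; descending = from-yes (allBits? λ v → ¬? (parent v ≟ v) →-dec (height (parent v) ℕ.<? height v))
    ; σ          = σ
    ; class      = class
    ; class-sym  = from-yes (allBits? λ u → allBits? λ v → class u v ≟ class v u)
    ; rainbow    = λ i {u} {v} → from-yes (allBits? λ i → allBits? λ u → allBits? λ v →
        (f i u ⊕ f i (parent u) ≟ f i v ⊕ f i (parent v)) →-dec (u ≟ v)) i u v
    ; sound      = from-yes (allBits? λ i → allBits? λ v →
        ¬? (parent v ≟ v) →-dec (class (f i v) (f i (parent v)) ≟ i))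
    ; complete   = from-yes (allBits? λ u → allBits? λ v → ¬? (u ≟ v) →-dec adjacent? u v (class u v))
    }

-- The edges (0,x)(1,y) between the halves are the cells of the Latin square x ⊕ y; those of tree t
-- form the transversal x ⊕ f y ≡ t, f the orthomorphism.

module Doubling {n} (O : Orthomorphism (suc n)) (T : TreePartition n) where

  open Orthomorphism O
  open TreePartition T

  -- Solves `x ⊕ f y ≡ t` for the end in the other half; the Boolean names the half of the given
  -- end.
  partner : Bits (suc n) → Bool → Bits (suc n) → Bits (suc n)
  partner t false x = from bijection (x ⊕ t)
  partner t true  y = to bijection y ⊕ t

  partner-inverse : ∀ t s x → partner t (not s) (partner t s x) ≡ x
  partner-inverse t false x = trans (cong (_⊕ t) (strictlyInverseˡ bijection _)) (⊕.cancelʳ x t)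
  partner-inverse t true  y = trans (cong (from bijection) (⊕.cancelʳ _ t)) (strictlyInverseʳ bijection y)

  partner-inverse′ : ∀ t s x → partner t s (partner t (not s) x) ≡ x
  partner-inverse′ t false = partner-inverse t true
  partner-inverse′ t true  = partner-inverse t false

  -- The label is `f x ⊕ x` shifted by `t`, and the orthomorphism recovers `x` from `f x ⊕ x`.
  partner-label-true : ∀ t {x y} → partner t true x ⊕ x ≡ partner t true y ⊕ y → x ≡ y
  partner-label-true t {x} {y} eq = trans (sym (recovers x)) (trans (cong recover fx⊕x≡fy⊕y) (recovers y))
    where
    fx⊕x≡fy⊕y = ⊕.cancelʳ-injective t
      (trans (sym (⊕.rotate (to bijection x) t x)) (trans eq (⊕.rotate (to bijection y) t y)))

  -- From the other half, read the same edge from its opposite end: the label does not change.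
  partner-label : ∀ t s {x y} → partner t s x ⊕ x ≡ partner t s y ⊕ y → x ≡ y
  partner-label t true  eq = partner-label-true t eq
  partner-label t false {x} {y} eq = trans (sym (partner-inverse t false x))
    (trans (cong (partner t true) (partner-label-true t (trans (flip x) (trans eq (sym (flip y))))))
           (partner-inverse t false y))
    where
    flip : ∀ x → partner t true (partner t false x) ⊕ partner t false x ≡ partner t false x ⊕ x
    flip x = trans (cong (_⊕ partner t false x) (partner-inverse t false x)) (⊕.comm x _)

  -- The leading bit of a model vertex is not its half: `false` marks the old tree, `true` the leaf
  -- hung on the old vertex `x`.
  parent² : Bits (2 + n) → Bits (2 + n)
  parent² (false ∷ x) = false ∷ parent x
  parent² (true  ∷ x) = false ∷ x

  height² : Bits (2 + n) → ℕ
  height² (false ∷ x) = height x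
  height² (true  ∷ x) = suc (height x)

  descending² : ∀ v → parent² v ≢ v → height² (parent² v) < height² v
  descending² (false ∷ x) ≢ = descending x (≢ ∘ cong (false ∷_))
  descending² (true  ∷ x) _ = ≤-refl

  -- The index `s ∷ i` is used twice: `s` selects the half that receives the copy of tree `i`, and
  -- the whole vector selects the transversal for the leaves.
  toHalf fromHalf : Bits (suc n) → Bits (2 + n) → Bits (2 + n)
  toHalf   (s ∷ i) (false ∷ x) = s ∷ to (σ i) x
  toHalf   (s ∷ i) (true  ∷ x) = not s ∷ partner (s ∷ i) s (to (σ i) x)
  fromHalf (false ∷ i) (false ∷ x) = false ∷ from (σ i) x
  fromHalf (false ∷ i) (true  ∷ x) = true  ∷ from (σ i) (partner (false ∷ i) true x)
  fromHalf (true  ∷ i) (false ∷ x) = true  ∷ from (σ i) (partner (true ∷ i) false x)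
  fromHalf (true  ∷ i) (true  ∷ x) = false ∷ from (σ i) x

  toHalf∘fromHalf : ∀ t x → toHalf t (fromHalf t x) ≡ x
  toHalf∘fromHalf (false ∷ i) (false ∷ x) = cong (false ∷_) (strictlyInverseˡ (σ i) x)
  toHalf∘fromHalf (true  ∷ i) (true  ∷ x) = cong (true ∷_) (strictlyInverseˡ (σ i) x)
  toHalf∘fromHalf (false ∷ i) (true  ∷ x) = cong (true ∷_)
    (trans (cong (partner (false ∷ i) false) (strictlyInverseˡ (σ i) _)) (partner-inverse (false ∷ i) true x))
  toHalf∘fromHalf (true  ∷ i) (false ∷ x) = cong (false ∷_)
    (trans (cong (partner (true ∷ i) true) (strictlyInverseˡ (σ i) _)) (partner-inverse (true ∷ i) false x))

  fromHalf∘toHalf : ∀ t x → fromHalf t (toHalf t x) ≡ x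
  fromHalf∘toHalf (false ∷ i) (false ∷ x) = cong (false ∷_) (strictlyInverseʳ (σ i) x)
  fromHalf∘toHalf (true  ∷ i) (false ∷ x) = cong (false ∷_) (strictlyInverseʳ (σ i) x)
  fromHalf∘toHalf (false ∷ i) (true  ∷ x) = cong (true ∷_)
    (trans (cong (from (σ i)) (partner-inverse (false ∷ i) false _)) (strictlyInverseʳ (σ i) x))
  fromHalf∘toHalf (true  ∷ i) (true  ∷ x) = cong (true ∷_)
    (trans (cong (from (σ i)) (partner-inverse (true ∷ i) true _)) (strictlyInverseʳ (σ i) x))

  transversal : Bits (suc n) → Bits (suc n) → Bits (suc n)
  transversal x y = x ⊕ to bijection y

  class² : Bits (2 + n) → Bits (2 + n) → Bits (suc n)
  class² (false ∷ x) (false ∷ y) = false ∷ class x y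
  class² (true  ∷ x) (true  ∷ y) = true ∷ class x y
  class² (false ∷ x) (true  ∷ y) = transversal x y
  class² (true  ∷ y) (false ∷ x) = transversal x y

  class²-sym : ∀ u v → class² u v ≡ class² v u
  class²-sym (false ∷ x) (false ∷ y) = cong (false ∷_) (class-sym x y)
  class²-sym (true  ∷ x) (true  ∷ y) = cong (true ∷_) (class-sym x y)
  class²-sym (false ∷ x) (true  ∷ y) = refl
  class²-sym (true  ∷ x) (false ∷ y) = refl

  rainbow² : ∀ t u v → toHalf t u ⊕ toHalf t (parent² u) ≡ toHalf t v ⊕ toHalf t (parent² v) → u ≡ v
  rainbow² (s     ∷ i) (false ∷ x) (false ∷ y) eq = cong (false ∷_) (rainbow i (∷-injectiveʳ eq))
  rainbow² (s     ∷ i) (true  ∷ x) (true  ∷ y) eq =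
    cong (true ∷_) (↔-injective (σ i) (partner-label (s ∷ i) s (∷-injectiveʳ eq)))
  -- A leaf edge crosses between the halves, so its label begins with `true`; labels from the old
  -- tree begin with `false`. Splitting on the half lets these bits compute.
  rainbow² (false ∷ i) (false ∷ x) (true  ∷ y) ()
  rainbow² (true  ∷ i) (false ∷ x) (true  ∷ y) ()
  rainbow² (false ∷ i) (true  ∷ x) (false ∷ y) ()
  rainbow² (true  ∷ i) (true  ∷ x) (false ∷ y) ()

  sound² : ∀ t v → parent² v ≢ v → class² (toHalf t v) (toHalf t (parent² v)) ≡ t
  sound² (false ∷ i) (false ∷ x) ≢ = cong (false ∷_) (sound i x (≢ ∘ cong (false ∷_)))
  sound² (true  ∷ i) (false ∷ x) ≢ = cong (true ∷_) (sound i x (≢ ∘ cong (false ∷_)))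
  sound² (false ∷ i) (true  ∷ x) _ =
    trans (cong (to (σ i) x ⊕_) (strictlyInverseˡ bijection _)) (⊕.cancelˡ (to (σ i) x) (false ∷ i))
  sound² (true  ∷ i) (true  ∷ x) _ =
    trans (cong (_⊕ to bijection (to (σ i) x)) (⊕.comm _ (true ∷ i))) (⊕.cancelʳ (true ∷ i) _)

  -- The leading bit of the transversal's index tells which half carries the old tree; the end in
  -- the other half is the leaf.
  crossing : ∀ x y → let t = transversal x y in
    parent² (fromHalf t (false ∷ x)) ≡ fromHalf t (true ∷ y) ⊎
    parent² (fromHalf t (true ∷ y)) ≡ fromHalf t (false ∷ x)
  crossing x y with transversal x y in eq
  ... | false ∷ i = inj₂ (cong (λ z → false ∷ from (σ i) z)
    (trans (cong (to bijection y ⊕_) (sym eq)) (⊕.conjugate (to bijection y) x)))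
  ... | true  ∷ i = inj₁ (cong (λ z → false ∷ from (σ i) z)
    (trans (cong (from bijection) (trans (cong (x ⊕_) (sym eq)) (⊕.cancelˡ x _))) (strictlyInverseʳ bijection y)))

  complete² : ∀ u v → u ≢ v → let t = class² u v in Adjacent parent² (fromHalf t u) (fromHalf t v)
  complete² (false ∷ x) (false ∷ y) u≢v =
    Sum.map (cong (false ∷_)) (cong (false ∷_)) (complete x y (u≢v ∘ cong (false ∷_)))
  complete² (true  ∷ x) (true  ∷ y) u≢v =
    Sum.map (cong (false ∷_)) (cong (false ∷_)) (complete x y (u≢v ∘ cong (true ∷_)))
  complete² (false ∷ x) (true  ∷ y) _ = crossing x y
  complete² (true  ∷ y) (false ∷ x) _ = swap (crossing x y)

  treePartition : TreePartition (suc n)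
  treePartition = record
    { parent     = parent²
    ; height     = height²
    ; descending = descending²
    ; σ          = λ t → mk↔ₛ′ (toHalf t) (fromHalf t) (toHalf∘fromHalf t) (fromHalf∘toHalf t)
    ; class      = class²
    ; class-sym  = class²-sym
    ; rainbow    = λ t {u} {v} → rainbow² t u v
    ; sound      = sound²
    ; complete   = complete²
    }

-- `TreePartition n` has 2ⁿ trees on 2ⁿ⁺¹ vertices, so the base has 8 vertices, and each doubling
-- takes an orthomorphism of the old vertex space.
treePartition : ∀ n → TreePartition (2 + n)
treePartition zero    = K₈.treePartition
treePartition (suc n) = Doubling.treePartition (orthomorphism (1 + n)) (treePartition n)

-- Transport along a bijection turning equality of colours into equality of sums

module Transport {n N m k} (T : TreePartition n) (φ : Bits (suc n) ↔ Fin N) (ι : Bits n ↔ Fin m)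
  (μ : Colouring N k)
  (colour⇒sum : ∀ {u v x y} → u ≢ v → x ≢ y → μ u v ≡ μ x y →
    from φ u ⊕ from φ v ≡ from φ x ⊕ from φ y) where

  open TreePartition T

  τ : Fin N → Fin N → Fin m
  τ u v = to ι (class (from φ u) (from φ v))

  τ-sym : ∀ u v → τ u v ≡ τ v u
  τ-sym u v = cong (to ι) (class-sym _ _)

  place : Fin m → Bits (suc n) ↔ Fin N
  place j = ↔-trans (σ (from ι j)) φ

  module _ (j : Fin m) where

    i = from ι j

    parentⱼ : Fin N → Fin N
    parentⱼ u = to (place j) (parent (from (place j) u))

    from-parentⱼ : ∀ u → from (place j) (parentⱼ u) ≡ parent (from (place j) u)
    from-parentⱼ u = strictlyInverseʳ (place j) _

    parent-place : ∀ {u v} → parent (from (place j) u) ≡ from (place j) v → parentⱼ u ≡ v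
    parent-place eq = trans (cong (to (place j)) eq) (strictlyInverseˡ (place j) _)

    from-φ : ∀ u → to (σ i) (from (place j) u) ≡ from φ u
    from-φ u = strictlyInverseˡ (σ i) _

    edge-to-parent : ∀ u → parentⱼ u ≢ u → ClassGraph τ j u (parentⱼ u) × ClassGraph τ j (parentⱼ u) u
    edge-to-parent u pu≢u = (≢-sym pu≢u , τ≡j) , pu≢u , trans (τ-sym _ u) τ≡j
      where
      τ≡j : τ u (parentⱼ u) ≡ j
      τ≡j = trans (cong (to ι) (trans
        (cong₂ class (sym (from-φ u)) (strictlyInverseʳ φ _))
        (sound i (from (place j) u) (pu≢u ∘ parent-place))))
        (strictlyInverseˡ ι j)

    edge⇒adjacent : ∀ {u v} → ClassGraph τ j u v → u ≢ v × Adjacent parentⱼ u v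
    edge⇒adjacent {u} {v} (u≢v , τ≡j) = u≢v , Sum.map parent-place parent-place adjacent
      where
      class≡i : class (from φ u) (from φ v) ≡ i
      class≡i = trans (sym (strictlyInverseʳ ι _)) (cong (from ι) τ≡j)
      adjacent : Adjacent parent (from (place j) u) (from (place j) v)
      adjacent = subst (λ i → Adjacent parent (from (σ i) (from φ u)) (from (σ i) (from φ v))) class≡i
        (complete _ _ (u≢v ∘ ↔-injective (↔-sym φ)))

    adjacent⇒edge : ∀ {u v} → u ≢ v → Adjacent parentⱼ u v → ClassGraph τ j u v
    adjacent⇒edge u≢v (inj₁ refl) = proj₁ (edge-to-parent _ (≢-sym u≢v))
    adjacent⇒edge u≢v (inj₂ refl) = proj₂ (edge-to-parent _ u≢v)

    label : Fin N → Bits (suc n)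
    label u = from φ u ⊕ from φ (parentⱼ u)

    label-injective : ∀ {u v} → label u ≡ label v → u ≡ v
    label-injective {u} {v} eq = ↔-injective (↔-sym (place j))
      (rainbow i (trans (sym (expand u)) (trans eq (expand v))))
      where
      expand : ∀ u → label u ≡ to (σ i) (from (place j) u) ⊕ to (σ i) (parent (from (place j) u))
      expand u = cong₂ _⊕_ (sym (from-φ u)) (strictlyInverseʳ φ _)

    -- Every root has label `𝟎`, and labels are injective.
    root-unique : ∀ {u v} → parentⱼ u ≡ u → parentⱼ v ≡ v → u ≡ v
    root-unique {u} {v} pu≡u pv≡v = label-injective (trans (root-label pu≡u) (sym (root-label pv≡v)))
      where
      root-label : ∀ {u} → parentⱼ u ≡ u → label u ≡ 𝟎
      root-label eq = trans (cong (λ v → _ ⊕ from φ v) eq) (⊕.square _)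

    heightⱼ : Fin N → ℕ
    heightⱼ u = height (from (place j) u)

    descendingⱼ : ∀ u → parentⱼ u ≢ u → heightⱼ (parentⱼ u) < heightⱼ u
    descendingⱼ u pu≢u = subst (λ x → height x < heightⱼ u) (sym (from-parentⱼ u))
      (descending _ (pu≢u ∘ parent-place))

    spanningTree : SpanningTree (ClassGraph τ j)
    spanningTree = ParentMap.spanningTree (ClassGraph τ j) parentⱼ heightⱼ
      edge-to-parent edge⇒adjacent descendingⱼ root-unique

    -- Each edge joins a child to its parent and carries the child's label. Equal colours give equal
    -- labels, hence the same child; `compare` sorts out which end that is.
    multicoloured : Multicoloured μ (ClassGraph τ j)
    multicoloured u v x y uv xy eq with edge⇒adjacent uv | edge⇒adjacent xy
    ... | u≢v , uv-adj | x≢y , xy-adj = compare uv-adj xy-adj (colour⇒sum u≢v x≢y eq)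
      where
      same : ∀ {u v x y} → parentⱼ u ≡ v → parentⱼ x ≡ y →
        from φ u ⊕ from φ v ≡ from φ x ⊕ from φ y → u ≡ x × v ≡ y
      same refl refl eq with label-injective eq
      ... | refl = refl , refl
      compare : ∀ {u v x y} → Adjacent parentⱼ u v → Adjacent parentⱼ x y →
        from φ u ⊕ from φ v ≡ from φ x ⊕ from φ y → (u ≡ x × v ≡ y) ⊎ (u ≡ y × v ≡ x)
      compare (inj₁ p) (inj₁ q) eq = inj₁ (same p q eq)
      compare (inj₁ p) (inj₂ q) eq = inj₂ (same p q (trans eq (⊕.comm _ _)))
      compare (inj₂ p) (inj₁ q) eq = inj₂ (Data.Product.swap (same p q (trans (⊕.comm _ _) eq)))
      compare (inj₂ p) (inj₂ q) eq =
        inj₁ (Data.Product.swap (same p q (trans (⊕.comm _ _) (trans eq (⊕.comm _ _)))))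

  -- Both graphs are placements of one model tree; passing through the model carries one parent map
  -- to the other.
  isomorphic : ∀ j l → Isomorphic (ClassGraph τ j) (ClassGraph τ l)
  isomorphic j l = θ , λ u v → forward , backward
    where
    θ = ↔-trans (↔-sym (place j)) (place l)

    parent-θ : ∀ u → parentⱼ l (to θ u) ≡ to θ (parentⱼ j u)
    parent-θ u = cong (to (place l)) (trans (cong parent (strictlyInverseʳ (place l) _)) (sym (from-parentⱼ j u)))

    forward : ∀ {u v} → ClassGraph τ j u v → ClassGraph τ l (to θ u) (to θ v)
    forward uv with edge⇒adjacent j uv
    ... | u≢v , adj = adjacent⇒edge l (u≢v ∘ ↔-injective θ)
      (Sum.map (trans (parent-θ _) ∘ cong (to θ)) (trans (parent-θ _) ∘ cong (to θ)) adj)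

    backward : ∀ {u v} → ClassGraph τ l (to θ u) (to θ v) → ClassGraph τ j u v
    backward uv with edge⇒adjacent l uv
    ... | θu≢θv , adj = adjacent⇒edge j (θu≢θv ∘ cong (to θ))
      (Sum.map (↔-injective θ ∘ trans (sym (parent-θ _))) (↔-injective θ ∘ trans (sym (parent-θ _))) adj)

-- The number of vertices as a power of two, and the theorem

exponent : ∀ {m} k → 2 < m → 2 * m ≡ 2 ^ k → ∃[ n ] (k ≡ 3 + n × m ≡ 2 ^ (2 + n))
exponent {suc (suc (suc _))} zero _ ()
exponent {1}     zero    (s≤s ())
exponent {2}     zero    (s≤s (s≤s ()))
exponent {m}     (suc k) 2<m eq with k | *-cancelˡ-≡ m (2 ^ k) 2 eq
... | 0           | refl  = contradiction 2<m λ { (s≤s ()) }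
... | 1           | refl  = contradiction 2<m λ { (s≤s (s≤s ())) }
... | suc (suc n) | m≡2^n = n , refl , m≡2^n

theorem4 : (m : ℕ) → 2 < m →
    (μ : Colouring (2 * m) (2 * m ∸ 1)) → Symmetric μ → Proper μ →
    (∀ (c d : Fin (2 * m ∸ 1)) → c ≢ d → FourCycleTwoFactor (TwoColourGraph μ c d)) →
    Σ (Fin (2 * m) → Fin (2 * m) → Fin m) λ τ →
    (∀ u v → τ u v ≡ τ v u) ×
    (∀ i → SpanningTree (ClassGraph τ i)) ×
    (∀ i → Multicoloured μ (ClassGraph τ i)) ×
    (∀ i j → Isomorphic (ClassGraph τ i) (ClassGraph τ j))
theorem4 1 (s≤s ())
theorem4 2 (s≤s (s≤s ()))
-- Exposing constructors of `m` makes `2 * m` and `2 * m ∸ 1` reduce to the successor forms in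
-- `Translations`.
theorem4 m@(suc (suc (suc _))) 2<m μ μ-sym proper fourCycles
  with Coordinates.coordinates (Translations.isBooleanGroup μ μ-sym proper fourCycles)
-- Counting the coordinate vectors gives 2m = 2^k.
... | k , φ , homo with exponent k 2<m (↔⇒≡ (↔-trans (↔-sym φ) (Bits↔Fin k)))
...   | n , refl , m≡2^n = τ , τ-sym , spanningTree , multicoloured , isomorphic
  where
  open Translations μ μ-sym proper fourCycles using (_∙_; colour-determines-∙)
  from-homo : ∀ u v → to φ (from φ u ⊕ from φ v) ≡ u ∙ v
  from-homo u v = trans (homo _ _) (cong₂ _∙_ (strictlyInverseˡ φ u) (strictlyInverseˡ φ v))
  open Transport (treePartition n) φ (subst (λ N → Bits (2 + n) ↔ Fin N) (sym m≡2^n) (Bits↔Fin (2 + n))) μ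
    (λ {u} {v} {x} {y} u≢v x≢y eq → ↔-injective φ
      (trans (from-homo u v) (trans (colour-determines-∙ u≢v x≢y eq) (sym (from-homo x y)))))
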